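{- Let $n\ge 2$ and let $A=(a_{ij})_{1\le i,j\le n}$ be the general $n\times n$ matrix, whose entries $a_{ij}$ are $n^2$ independent commuting indeterminates. Let $S\subseteq\{(i,j)\mid 1\le i,j\le n,\ i\ne j\}$ be any set of $n$ non-diagonal positions. Then there exist polynomials $q_s\in\mathbb{Q}[a_{ij}: 1\le i,j\le n]$, $s\in S$, not all zero and independent of $m$, such that $$\sum_{s\in S} q_s\cdot (A^m)_s=0$$ for all integers $m>1$.
   Context: For a matrix $B$ and a position $s=(i,j)$, $B_s=B_{ij}$ denotes the $(i,j)$ entry of $B$. The polynomials $q_s$ may depend on $n$ and $S$ but not on the exponent $m$. -}

module Defs where

open import Level using (0ℓ)
open import Algebra.Bundles.Raw using (RawRing)
import Algebra.Definitions.RawMonoid as RawMonoidDefs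
open import Data.Bool.Base using (if_then_else_)
open import Data.Fin.Base using (Fin; zero; suc; combine)
open import Data.Fin.Properties using (_≟_)
open import Data.List.Base using (List; []; _∷_; map)
open import Data.Nat.Base as ℕ using (ℕ; zero; suc)
open import Data.Product.Base using (_×_; _,_)
import Data.Rational.Base as ℚ
open import Relation.Nullary.Decidable.Core using (does)

-- R[X]: the list a₀ ∷ a₁ ∷ … ∷ [] stands for a₀ + a₁ X + ….  Trailing zeros
-- are allowed, so equality of polynomials is equality of all coefficients.
module Univariate {c ℓ} (R : RawRing c ℓ) where
  open RawRing R

  coeff : List Carrier → ℕ → Carrier
  coeff []      _       = 0#
  coeff (a ∷ p) zero    = a
  coeff (a ∷ p) (suc i) = coeff p i

  infix  4 _≈ₚ_
  infixl 6 _+ₚ_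
  infixl 7 _*ₚ_

  _≈ₚ_ : List Carrier → List Carrier → Set ℓ
  p ≈ₚ q = ∀ i → coeff p i ≈ coeff q i

  _+ₚ_ : List Carrier → List Carrier → List Carrier
  []      +ₚ q       = q
  (a ∷ p) +ₚ []      = a ∷ p
  (a ∷ p) +ₚ (b ∷ q) = (a + b) ∷ (p +ₚ q)

  -- (a + X p) q = a q + X (p q)
  _*ₚ_ : List Carrier → List Carrier → List Carrier
  []      *ₚ q = []
  (a ∷ p) *ₚ q = map (a *_) q +ₚ (0# ∷ (p *ₚ q))

  rawRing : RawRing c ℓ
  rawRing = record
    { Carrier = List Carrier
    ; _≈_     = _≈ₚ_
    ; _+_     = _+ₚ_
    ; _*_     = _*ₚ_
    ; -_      = map (-_)
    ; 0#      = []
    ; 1#      = 1# ∷ []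
    }

  constant : Carrier → List Carrier
  constant a = a ∷ []

  X : List Carrier
  X = 0# ∷ 1# ∷ []

-- ℚ[x₀, …, x_{k-1}], built by adjoining one indeterminate at a time.
ℚ[_] : ℕ → RawRing 0ℓ 0ℓ
ℚ[ zero  ] = ℚ.+-*-rawRing
ℚ[ suc k ] = Univariate.rawRing ℚ[ k ]

indeterminate : ∀ {k} → Fin k → RawRing.Carrier ℚ[ k ]
indeterminate {suc k} zero    = Univariate.X ℚ[ k ]
indeterminate {suc k} (suc i) = Univariate.constant ℚ[ k ] (indeterminate i)

module Matrices {c ℓ} (R : RawRing c ℓ) where
  open RawRing R
  open RawMonoidDefs +-rawMonoid public using (sum)

  Matrix : ℕ → Set c
  Matrix n = Fin n → Fin n → Carrier

  infix  10 _at_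
  infixl 7 _*ₘ_
  infixr 8 _^ₘ_

  _at_ : ∀ {n} → Matrix n → Fin n × Fin n → Carrier
  B at (i , j) = B i j

  1ₘ : ∀ {n} → Matrix n
  1ₘ i j = if does (i ≟ j) then 1# else 0#

  _*ₘ_ : ∀ {n} → Matrix n → Matrix n → Matrix n
  (B *ₘ C) i j = sum (λ k → B i k * C k j)

  _^ₘ_ : ∀ {n} → Matrix n → ℕ → Matrix n
  B ^ₘ zero  = 1ₘ
  B ^ₘ suc m = B *ₘ (B ^ₘ m)

-- ℚ[aᵢⱼ : i, j < n]; the position (i , j) is numbered by
-- combine i j : Fin (n * n), which is a bijection.
ℚ[a] : ℕ → RawRing 0ℓ 0ℓ
ℚ[a] n = ℚ[ n ℕ.* n ]

generalMatrix : ∀ n → Matrices.Matrix (ℚ[a] n) n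
generalMatrix n i j = indeterminate (combine i j)

{-# OPTIONS --safe #-}

-- By Cayley–Hamilton every entry of A ^ m, as a sequence in m, satisfies one common
-- monic linear recurrence of order n, and so does f m = ∑ₛ qₛ (A ^ m)ₛ.  Hence f vanishes
-- as soon as f 0 = … = f (n - 1) = 0.  Off the diagonal f 0 = 0 is automatic, and the
-- other n - 1 conditions are homogeneous linear equations in the n unknowns qₛ over a
-- domain, so they have a nonzero solution.
--
-- For Cayley–Hamilton, let R[X] act on sequences by the shift and work in the exterior
-- algebra of R[X] ^ n: replacing one row of X - Aᵀ in the wedge product of its rows gives
-- a linear form, hence the adjugate, and the top coordinate of the product itself is the
-- characteristic polynomial.
module Submission where

open import Defs
open import Algebra.Bundles using (CommutativeRing)
open import Algebra.Bundles.Raw using (RawRing)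
import Algebra.Consequences.Setoid as Consequences
import Algebra.Properties.CommutativeMonoid.Sum as CommutativeMonoidSum
import Algebra.Properties.CommutativeSemigroup as CommutativeSemigroupProperties
import Algebra.Properties.Ring as RingProperties
import Algebra.Properties.Semiring.Sum as SemiringSum
open import Algebra.Structures using (IsCommutativeRing)
open import Data.Fin.Base using (Fin; zero; suc; punchIn; punchOut; toℕ; fromℕ<)
open import Data.Fin.Properties using (_≟_; any?; punchIn-punchOut; suc-injective; toℕ-fromℕ<)
open import Data.Fin.Subset using (Subset; inside; outside; ⊤)
open import Data.List.Base using (List; []; _∷_; map)
open import Data.Nat.Base as ℕ using (ℕ; zero; suc; _≤_; _<_)
import Data.Nat.Properties as ℕ
open import Data.Product.Base using (_×_; _,_; Σ-syntax; ∃-syntax; proj₁; proj₂)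
open import Data.Rational.Base as ℚ using (0ℚ)
import Data.Rational.Properties as ℚ
open import Data.Sum.Base using (_⊎_; inj₁; inj₂; [_,_]′)
open import Data.Vec.Base using ([]; _∷_)
open import Data.Vec.Functional using (head; tail)
open import Function.Base using (_∘_)
open import Function.Definitions using (Injective)
open import Level using (0ℓ; _⊔_)
open import Relation.Binary.Bundles using (Setoid)
open import Relation.Binary.PropositionalEquality as ≡ using (_≡_; _≢_)
import Relation.Binary.Reasoning.Setoid as SetoidReasoning
open import Relation.Nullary.Decidable using (Dec; yes; no; ¬?; decidable-stable)
open import Relation.Nullary.Negation using (contradiction)

-- The commutative ring of polynomials as coefficient lists.

module PolynomialRing {c ℓ} (R : CommutativeRing c ℓ) where
  open CommutativeRing R
  open Univariate rawRing hiding (rawRing)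
  open RingProperties ring using (-0#≈0#)
  open CommutativeSemigroupProperties +-commutativeSemigroup using (interchange; x∙yz≈y∙xz)
  open SetoidReasoning setoid

  coeff-+ : ∀ p q i → coeff (p +ₚ q) i ≈ coeff p i + coeff q i
  coeff-+ []      q       i       = sym (+-identityˡ _)
  coeff-+ (a ∷ p) []      i       = sym (+-identityʳ _)
  coeff-+ (a ∷ p) (b ∷ q) zero    = refl
  coeff-+ (a ∷ p) (b ∷ q) (suc i) = coeff-+ p q i

  coeff-scale : ∀ a p i → coeff (map (a *_) p) i ≈ a * coeff p i
  coeff-scale a []      i       = sym (zeroʳ a)
  coeff-scale a (b ∷ p) zero    = refl
  coeff-scale a (b ∷ p) (suc i) = coeff-scale a p i

  coeff-neg : ∀ p i → coeff (map (-_) p) i ≈ - coeff p i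
  coeff-neg []      i       = sym -0#≈0#
  coeff-neg (b ∷ p) zero    = refl
  coeff-neg (b ∷ p) (suc i) = coeff-neg p i

  0∷[]≈[] : (0# ∷ []) ≈ₚ []
  0∷[]≈[] zero    = refl
  0∷[]≈[] (suc i) = refl

  coeff-∷*-zero : ∀ a p q → coeff ((a ∷ p) *ₚ q) 0 ≈ a * coeff q 0
  coeff-∷*-zero a p q = begin
    coeff (map (a *_) q +ₚ (0# ∷ p *ₚ q)) 0  ≈⟨ coeff-+ (map (a *_) q) _ 0 ⟩
    coeff (map (a *_) q) 0 + 0#              ≈⟨ +-identityʳ _ ⟩
    coeff (map (a *_) q) 0                   ≈⟨ coeff-scale a q 0 ⟩
    a * coeff q 0                            ∎

  coeff-∷*-suc : ∀ a p q i →
    coeff ((a ∷ p) *ₚ q) (suc i) ≈ a * coeff q (suc i) + coeff (p *ₚ q) i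
  coeff-∷*-suc a p q i =
    trans (coeff-+ (map (a *_) q) _ (suc i)) (+-congʳ (coeff-scale a q (suc i)))

  *ₚ-congˡ : ∀ p {q r} → q ≈ₚ r → p *ₚ q ≈ₚ p *ₚ r
  *ₚ-congˡ []      q≈r i = refl
  *ₚ-congˡ (a ∷ p) {q} {r} q≈r zero = begin
    coeff ((a ∷ p) *ₚ q) 0  ≈⟨ coeff-∷*-zero a p q ⟩
    a * coeff q 0           ≈⟨ *-congˡ (q≈r 0) ⟩
    a * coeff r 0           ≈⟨ coeff-∷*-zero a p r ⟨
    coeff ((a ∷ p) *ₚ r) 0  ∎
  *ₚ-congˡ (a ∷ p) {q} {r} q≈r (suc i) = begin
    coeff ((a ∷ p) *ₚ q) (suc i)               ≈⟨ coeff-∷*-suc a p q i ⟩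
    a * coeff q (suc i) + coeff (p *ₚ q) i     ≈⟨ +-cong (*-congˡ (q≈r (suc i))) (*ₚ-congˡ p q≈r i) ⟩
    a * coeff r (suc i) + coeff (p *ₚ r) i     ≈⟨ coeff-∷*-suc a p r i ⟨
    coeff ((a ∷ p) *ₚ r) (suc i)               ∎

  *ₚ-zeroʳ : ∀ p → p *ₚ [] ≈ₚ []
  *ₚ-zeroʳ []      i       = refl
  *ₚ-zeroʳ (a ∷ p) zero    = refl
  *ₚ-zeroʳ (a ∷ p) (suc i) = *ₚ-zeroʳ p i

  coeff-*∷-zero : ∀ p b q → coeff (p *ₚ (b ∷ q)) 0 ≈ coeff p 0 * b
  coeff-*∷-zero []      b q = sym (zeroˡ b)
  coeff-*∷-zero (a ∷ p) b q = coeff-∷*-zero a p (b ∷ q)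

  -- The mirror image of `coeff-∷*-suc`: it peels the constant term off the right factor although
  -- `*ₚ` recurses on the left one. Comparing the two recursions gives commutativity; later both
  -- serve to cancel a factor X.
  coeff-*∷-suc : ∀ p b q i →
    coeff (p *ₚ (b ∷ q)) (suc i) ≈ coeff p (suc i) * b + coeff (p *ₚ q) i
  coeff-*∷-suc []      b q i    = sym (trans (+-identityʳ _) (zeroˡ b))
  coeff-*∷-suc (a ∷ p) b q zero = begin
    coeff ((a ∷ p) *ₚ (b ∷ q)) 1               ≈⟨ coeff-∷*-suc a p (b ∷ q) 0 ⟩
    a * coeff q 0 + coeff (p *ₚ (b ∷ q)) 0     ≈⟨ +-cong (coeff-∷*-zero a p q) (sym (coeff-*∷-zero p b q)) ⟨
    coeff ((a ∷ p) *ₚ q) 0 + coeff p 0 * b     ≈⟨ +-comm _ _ ⟩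
    coeff p 0 * b + coeff ((a ∷ p) *ₚ q) 0     ∎
  coeff-*∷-suc (a ∷ p) b q (suc i) = begin
    coeff ((a ∷ p) *ₚ (b ∷ q)) (suc (suc i))                        ≈⟨ coeff-∷*-suc a p (b ∷ q) (suc i) ⟩
    a * coeff q (suc i) + coeff (p *ₚ (b ∷ q)) (suc i)              ≈⟨ +-congˡ (coeff-*∷-suc p b q i) ⟩
    a * coeff q (suc i) + (coeff p (suc i) * b + coeff (p *ₚ q) i)  ≈⟨ x∙yz≈y∙xz _ _ _ ⟩
    coeff p (suc i) * b + (a * coeff q (suc i) + coeff (p *ₚ q) i)  ≈⟨ +-congˡ (coeff-∷*-suc a p q i) ⟨
    coeff p (suc i) * b + coeff ((a ∷ p) *ₚ q) (suc i)              ∎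

  -- Both products unfold at `b ∷ q` into the same recursion, so induction on the right factor
  -- suffices. Coming early, it turns the left-hand congruence, distributivity and identity laws
  -- into their right-hand counterparts.
  *ₚ-comm : ∀ p q → p *ₚ q ≈ₚ q *ₚ p
  *ₚ-comm p []      i       = *ₚ-zeroʳ p i
  *ₚ-comm p (b ∷ q) zero    = begin
    coeff (p *ₚ (b ∷ q)) 0  ≈⟨ coeff-*∷-zero p b q ⟩
    coeff p 0 * b           ≈⟨ *-comm _ _ ⟩
    b * coeff p 0           ≈⟨ coeff-∷*-zero b q p ⟨
    coeff ((b ∷ q) *ₚ p) 0  ∎
  *ₚ-comm p (b ∷ q) (suc i) = begin
    coeff (p *ₚ (b ∷ q)) (suc i)            ≈⟨ coeff-*∷-suc p b q i ⟩
    coeff p (suc i) * b + coeff (p *ₚ q) i  ≈⟨ +-cong (*-comm _ _) (*ₚ-comm p q i) ⟩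
    b * coeff p (suc i) + coeff (q *ₚ p) i  ≈⟨ coeff-∷*-suc b q p i ⟨
    coeff ((b ∷ q) *ₚ p) (suc i)            ∎

  *ₚ-congʳ : ∀ {p q} r → p ≈ₚ q → p *ₚ r ≈ₚ q *ₚ r
  *ₚ-congʳ {p} {q} r p≈q i = begin
    coeff (p *ₚ r) i  ≈⟨ *ₚ-comm p r i ⟩
    coeff (r *ₚ p) i  ≈⟨ *ₚ-congˡ r p≈q i ⟩
    coeff (r *ₚ q) i  ≈⟨ *ₚ-comm r q i ⟩
    coeff (q *ₚ r) i  ∎

  *ₚ-distribˡ : ∀ p q r → p *ₚ (q +ₚ r) ≈ₚ p *ₚ q +ₚ p *ₚ r
  *ₚ-distribˡ []      q r i       = refl
  *ₚ-distribˡ (a ∷ p) q r zero    = begin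
    coeff ((a ∷ p) *ₚ (q +ₚ r)) 0                    ≈⟨ coeff-∷*-zero a p (q +ₚ r) ⟩
    a * coeff (q +ₚ r) 0                             ≈⟨ *-congˡ (coeff-+ q r 0) ⟩
    a * (coeff q 0 + coeff r 0)                      ≈⟨ distribˡ a _ _ ⟩
    a * coeff q 0 + a * coeff r 0                    ≈⟨ +-cong (coeff-∷*-zero a p q) (coeff-∷*-zero a p r) ⟨
    coeff ((a ∷ p) *ₚ q) 0 + coeff ((a ∷ p) *ₚ r) 0  ≈⟨ coeff-+ ((a ∷ p) *ₚ q) _ 0 ⟨
    coeff ((a ∷ p) *ₚ q +ₚ (a ∷ p) *ₚ r) 0           ∎
  *ₚ-distribˡ (a ∷ p) q r (suc i) = begin
    coeff ((a ∷ p) *ₚ (q +ₚ r)) (suc i)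
      ≈⟨ coeff-∷*-suc a p (q +ₚ r) i ⟩
    a * coeff (q +ₚ r) (suc i) + coeff (p *ₚ (q +ₚ r)) i
      ≈⟨ +-cong (*-congˡ (coeff-+ q r (suc i))) (trans (*ₚ-distribˡ p q r i) (coeff-+ (p *ₚ q) _ i)) ⟩
    a * (coeff q (suc i) + coeff r (suc i)) + (coeff (p *ₚ q) i + coeff (p *ₚ r) i)
      ≈⟨ +-congʳ (distribˡ a _ _) ⟩
    (a * coeff q (suc i) + a * coeff r (suc i)) + (coeff (p *ₚ q) i + coeff (p *ₚ r) i)
      ≈⟨ interchange _ _ _ _ ⟩
    (a * coeff q (suc i) + coeff (p *ₚ q) i) + (a * coeff r (suc i) + coeff (p *ₚ r) i)
      ≈⟨ +-cong (coeff-∷*-suc a p q i) (coeff-∷*-suc a p r i) ⟨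
    coeff ((a ∷ p) *ₚ q) (suc i) + coeff ((a ∷ p) *ₚ r) (suc i)
      ≈⟨ coeff-+ ((a ∷ p) *ₚ q) _ (suc i) ⟨
    coeff ((a ∷ p) *ₚ q +ₚ (a ∷ p) *ₚ r) (suc i) ∎

  +ₚ-cong : ∀ {p q r s} → p ≈ₚ q → r ≈ₚ s → p +ₚ r ≈ₚ q +ₚ s
  +ₚ-cong {p} {q} {r} {s} p≈q r≈s i = begin
    coeff (p +ₚ r) i       ≈⟨ coeff-+ p r i ⟩
    coeff p i + coeff r i  ≈⟨ +-cong (p≈q i) (r≈s i) ⟩
    coeff q i + coeff s i  ≈⟨ coeff-+ q s i ⟨
    coeff (q +ₚ s) i       ∎

  *ₚ-distribʳ : ∀ r p q → (p +ₚ q) *ₚ r ≈ₚ p *ₚ r +ₚ q *ₚ r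
  *ₚ-distribʳ r p q i = begin
    coeff ((p +ₚ q) *ₚ r) i     ≈⟨ *ₚ-comm (p +ₚ q) r i ⟩
    coeff (r *ₚ (p +ₚ q)) i     ≈⟨ *ₚ-distribˡ r p q i ⟩
    coeff (r *ₚ p +ₚ r *ₚ q) i  ≈⟨ +ₚ-cong {r *ₚ p} {p *ₚ r} {r *ₚ q} {q *ₚ r} (*ₚ-comm r p) (*ₚ-comm r q) i ⟩
    coeff (p *ₚ r +ₚ q *ₚ r) i  ∎

  *ₚ-assoc-scale : ∀ a p q i → coeff (map (a *_) p *ₚ q) i ≈ a * coeff (p *ₚ q) i
  *ₚ-assoc-scale a []      q i       = sym (zeroʳ a)
  *ₚ-assoc-scale a (b ∷ p) q zero    = begin
    coeff ((a * b ∷ map (a *_) p) *ₚ q) 0  ≈⟨ coeff-∷*-zero (a * b) (map (a *_) p) q ⟩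
    (a * b) * coeff q 0                    ≈⟨ *-assoc a b _ ⟩
    a * (b * coeff q 0)                    ≈⟨ *-congˡ (coeff-∷*-zero b p q) ⟨
    a * coeff ((b ∷ p) *ₚ q) 0             ∎
  *ₚ-assoc-scale a (b ∷ p) q (suc i) = begin
    coeff ((a * b ∷ map (a *_) p) *ₚ q) (suc i)                   ≈⟨ coeff-∷*-suc (a * b) (map (a *_) p) q i ⟩
    (a * b) * coeff q (suc i) + coeff (map (a *_) p *ₚ q) i       ≈⟨ +-cong (*-assoc a b _) (*ₚ-assoc-scale a p q i) ⟩
    a * (b * coeff q (suc i)) + a * coeff (p *ₚ q) i              ≈⟨ distribˡ a _ _ ⟨
    a * (b * coeff q (suc i) + coeff (p *ₚ q) i)                  ≈⟨ *-congˡ (coeff-∷*-suc b p q i) ⟨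
    a * coeff ((b ∷ p) *ₚ q) (suc i)                              ∎

  *ₚ-assoc : ∀ p q r → (p *ₚ q) *ₚ r ≈ₚ p *ₚ (q *ₚ r)
  *ₚ-assoc []      q r i = refl
  *ₚ-assoc (a ∷ p) q r i = begin
    coeff (((a ∷ p) *ₚ q) *ₚ r) i
      ≈⟨ *ₚ-distribʳ r (map (a *_) q) (0# ∷ p *ₚ q) i ⟩
    coeff (map (a *_) q *ₚ r +ₚ (0# ∷ p *ₚ q) *ₚ r) i
      ≈⟨ coeff-+ (map (a *_) q *ₚ r) _ i ⟩
    coeff (map (a *_) q *ₚ r) i + coeff ((0# ∷ p *ₚ q) *ₚ r) i
      ≈⟨ +-cong (trans (*ₚ-assoc-scale a q r i) (sym (coeff-scale a (q *ₚ r) i))) (shifted i) ⟩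
    coeff (map (a *_) (q *ₚ r)) i + coeff (0# ∷ p *ₚ (q *ₚ r)) i
      ≈⟨ coeff-+ (map (a *_) (q *ₚ r)) _ i ⟨
    coeff ((a ∷ p) *ₚ (q *ₚ r)) i ∎
    where
    -- A factor X can be pulled out of the product with `r`; this carries the induction hypothesis
    -- for the tail `p`.
    shifted : (0# ∷ p *ₚ q) *ₚ r ≈ₚ 0# ∷ p *ₚ (q *ₚ r)
    shifted zero    = trans (coeff-∷*-zero 0# (p *ₚ q) r) (zeroˡ _)
    shifted (suc j) = begin
      coeff ((0# ∷ p *ₚ q) *ₚ r) (suc j)               ≈⟨ coeff-∷*-suc 0# (p *ₚ q) r j ⟩
      0# * coeff r (suc j) + coeff ((p *ₚ q) *ₚ r) j   ≈⟨ +-congʳ (zeroˡ _) ⟩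
      0# + coeff ((p *ₚ q) *ₚ r) j                     ≈⟨ +-identityˡ _ ⟩
      coeff ((p *ₚ q) *ₚ r) j                          ≈⟨ *ₚ-assoc p q r j ⟩
      coeff (p *ₚ (q *ₚ r)) j                          ∎

  *ₚ-identityˡ : ∀ p → (1# ∷ []) *ₚ p ≈ₚ p
  *ₚ-identityˡ p i = begin
    coeff (map (1# *_) p +ₚ (0# ∷ [])) i             ≈⟨ coeff-+ (map (1# *_) p) _ i ⟩
    coeff (map (1# *_) p) i + coeff (0# ∷ []) i      ≈⟨ +-cong (coeff-scale 1# p i) (0∷[]≈[] i) ⟩
    1# * coeff p i + 0#                              ≈⟨ +-identityʳ _ ⟩
    1# * coeff p i                                   ≈⟨ *-identityˡ _ ⟩
    coeff p i                                        ∎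

  +ₚ-assoc : ∀ p q r → (p +ₚ q) +ₚ r ≈ₚ p +ₚ (q +ₚ r)
  +ₚ-assoc p q r i = begin
    coeff ((p +ₚ q) +ₚ r) i              ≈⟨ coeff-+ (p +ₚ q) r i ⟩
    coeff (p +ₚ q) i + coeff r i         ≈⟨ +-congʳ (coeff-+ p q i) ⟩
    (coeff p i + coeff q i) + coeff r i  ≈⟨ +-assoc _ _ _ ⟩
    coeff p i + (coeff q i + coeff r i)  ≈⟨ +-congˡ (coeff-+ q r i) ⟨
    coeff p i + coeff (q +ₚ r) i         ≈⟨ coeff-+ p (q +ₚ r) i ⟨
    coeff (p +ₚ (q +ₚ r)) i              ∎

  +ₚ-comm : ∀ p q → p +ₚ q ≈ₚ q +ₚ p
  +ₚ-comm p q i = trans (coeff-+ p q i) (trans (+-comm _ _) (sym (coeff-+ q p i)))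

  -ₚ-inverseˡ : ∀ p → map (-_) p +ₚ p ≈ₚ []
  -ₚ-inverseˡ p i = begin
    coeff (map (-_) p +ₚ p) i          ≈⟨ coeff-+ (map (-_) p) p i ⟩
    coeff (map (-_) p) i + coeff p i   ≈⟨ +-congʳ (coeff-neg p i) ⟩
    - coeff p i + coeff p i            ≈⟨ -‿inverseˡ _ ⟩
    0#                                 ∎

  -ₚ-cong : ∀ {p q} → p ≈ₚ q → map (-_) p ≈ₚ map (-_) q
  -ₚ-cong {p} {q} p≈q i =
    trans (coeff-neg p i) (trans (-‿cong (p≈q i)) (sym (coeff-neg q i)))

  polynomialSetoid : Setoid c ℓ
  polynomialSetoid = record
    { Carrier       = List Carrier
    ; _≈_           = _≈ₚ_
    ; isEquivalence = record
      { refl  = λ i → refl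
      ; sym   = λ p≈q i → sym (p≈q i)
      ; trans = λ p≈q q≈r i → trans (p≈q i) (q≈r i)
      }
    }

  open Consequences polynomialSetoid using (comm∧idˡ⇒id; comm∧invˡ⇒inv)

  isCommutativeRingₚ : IsCommutativeRing _≈ₚ_ _+ₚ_ _*ₚ_ (map (-_)) [] (1# ∷ [])
  isCommutativeRingₚ = record
    { isRing = record
      { +-isAbelianGroup = record
        { isGroup = record
          { isMonoid = record
            { isSemigroup = record
              { isMagma = record
                { isEquivalence = Setoid.isEquivalence polynomialSetoid
                ; ∙-cong        = λ {p} {q} → +ₚ-cong {p} {q}
                }
              ; assoc = +ₚ-assoc
              }
            ; identity = comm∧idˡ⇒id {_+ₚ_} +ₚ-comm {[]} (λ p i → refl)
            }
          ; inverse = comm∧invˡ⇒inv {_+ₚ_} {map (-_)} {[]} +ₚ-comm -ₚ-inverseˡ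
          ; ⁻¹-cong = λ {p} {q} → -ₚ-cong {p} {q}
          }
        ; comm = +ₚ-comm
        }
      ; *-cong     = λ {p} {q} {r} {s} p≈q r≈s i → trans (*ₚ-congʳ {p} {q} r p≈q i) (*ₚ-congˡ q {r} {s} r≈s i)
      ; *-assoc    = *ₚ-assoc
      ; *-identity = comm∧idˡ⇒id {_*ₚ_} *ₚ-comm {1# ∷ []} *ₚ-identityˡ
      ; distrib    = *ₚ-distribˡ , *ₚ-distribʳ
      }
    ; *-comm = *ₚ-comm
    }

  commutativeRing : CommutativeRing c ℓ
  commutativeRing = record { isCommutativeRing = isCommutativeRingₚ }

-- Finite sums and the identity matrix.

module Sums {c ℓ} (R : CommutativeRing c ℓ) where
  open CommutativeRing R hiding (zero)
  open RingProperties ring using (-0#≈0#; -‿+-comm)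
  open SemiringSum semiring public using (sum; sum-cong-≋; sum-replicate-zero; *-distribˡ-sum)
  open CommutativeMonoidSum +-commutativeMonoid public using (∑-distrib-+; ∑-comm)
  open Matrices rawRing using (1ₘ)

  sum-zero : ∀ {n} (f : Fin n → Carrier) → (∀ i → f i ≈ 0#) → sum f ≈ 0#
  sum-zero {n} f f≈0 = trans (sum-cong-≋ f≈0) (sum-replicate-zero n)

  sum-single : ∀ {n} (f : Fin n → Carrier) i → (∀ j → j ≢ i → f j ≈ 0#) → sum f ≈ f i
  sum-single f zero    f≈0 =
    trans (+-congˡ (sum-zero (f ∘ suc) (λ j → f≈0 (suc j) λ ()))) (+-identityʳ _)
  sum-single f (suc i) f≈0 = trans
    (+-cong (f≈0 zero λ ()) (sum-single (f ∘ suc) i (λ j j≢i → f≈0 (suc j) (j≢i ∘ suc-injective))))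
    (+-identityˡ _)

  sum-neg : ∀ {n} (f : Fin n → Carrier) → sum (λ i → - f i) ≈ - sum f
  sum-neg {zero}  f = sym -0#≈0#
  sum-neg {suc n} f = trans (+-congˡ (sum-neg (f ∘ suc))) (-‿+-comm _ _)

  1ₘ-diagonal : ∀ {n} (i : Fin n) → 1ₘ i i ≈ 1#
  1ₘ-diagonal zero    = refl
  1ₘ-diagonal (suc i) = 1ₘ-diagonal i

  1ₘ-offDiagonal : ∀ {n} (i j : Fin n) → i ≢ j → 1ₘ i j ≈ 0#
  1ₘ-offDiagonal zero    zero    i≢j = contradiction ≡.refl i≢j
  1ₘ-offDiagonal zero    (suc j) i≢j = refl
  1ₘ-offDiagonal (suc i) zero    i≢j = refl
  1ₘ-offDiagonal (suc i) (suc j) i≢j = 1ₘ-offDiagonal i j (i≢j ∘ ≡.cong suc)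

-- Exterior algebra, determinants and the adjugate.

-- A multivector is given by its coordinates in the basis e_S (S ⊆ {0, …, n-1}) of
-- the exterior algebra of R ^ n.
module Exterior {c ℓ} (R : CommutativeRing c ℓ) where
  open CommutativeRing R hiding (zero)
  open RingProperties ring
    using (-0#≈0#; -‿+-comm; ⁻¹-anti-homo-//; x[y-z]≈xy-xz)
  open CommutativeSemigroupProperties +-commutativeSemigroup using (interchange)
  open CommutativeSemigroupProperties *-commutativeSemigroup
    using () renaming (x∙yz≈y∙xz to x*yz≈y*xz)
  open SetoidReasoning setoid
  open Sums R
  open Matrices rawRing using (1ₘ)

  Multivector : ℕ → Set c
  Multivector n = Subset n → Carrier

  infixr 6 _∧_

  -- Split off the first basis vector e and write v = v₀ e + v′, x = x₀ + e ∧ x₁; then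
  -- v ∧ x = v′ ∧ x₀ + e ∧ (v₀ x₀ - v′ ∧ x₁).
  _∧_ : ∀ {n} → (Fin n → Carrier) → Multivector n → Multivector n
  (v ∧ x) []            = 0#
  (v ∧ x) (outside ∷ s) = (tail v ∧ (x ∘ (outside ∷_))) s
  (v ∧ x) (inside  ∷ s) = head v * x (outside ∷ s) - (tail v ∧ (x ∘ (inside ∷_))) s

  unit : ∀ {n} → Multivector n
  unit []            = 1#
  unit (outside ∷ s) = unit s
  unit (inside  ∷ s) = 0#

  -- For a square matrix the coordinate at `⊤` is the determinant. Separate `m` and `n` let
  -- inductions drop rows while the columns stay fixed.
  ⋀ : ∀ {m n} → (Fin m → Fin n → Carrier) → Multivector n
  ⋀ {zero}  M = unit
  ⋀ {suc m} M = M zero ∧ ⋀ (M ∘ suc)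

  private
    x-0≈x : ∀ x → x - 0# ≈ x
    x-0≈x x = trans (+-congˡ -0#≈0#) (+-identityʳ x)

    0-0 : ∀ {x y} → x ≈ 0# → y ≈ 0# → x - y ≈ 0#
    0-0 x≈0 y≈0 = trans (+-cong x≈0 (-‿cong y≈0)) (x-0≈x 0#)

    x-[x-0]≈0 : ∀ x {y} → y ≈ 0# → x - (x - y) ≈ 0#
    x-[x-0]≈0 x {y} y≈0 = begin
      x - (x - y)  ≈⟨ +-congˡ (-‿cong (trans (+-congˡ (-‿cong y≈0)) (x-0≈x x))) ⟩
      x - x        ≈⟨ -‿inverseʳ x ⟩
      0#           ∎

    sub-interchange : ∀ a b c d → (a - b) - (c - d) ≈ (a - c) - (b - d)
    sub-interchange a b c d = begin
      (a - b) - (c - d)      ≈⟨ +-congˡ (-‿+-comm c (- d)) ⟨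
      (a - b) + (- c - - d)  ≈⟨ interchange a (- b) (- c) (- - d) ⟩
      (a - c) + (- b - - d)  ≈⟨ +-congˡ (-‿+-comm b (- d)) ⟩
      (a - c) - (b - d)      ∎

  ∧-cong : ∀ {n} (v : Fin n → Carrier) {x y : Multivector n} →
           (∀ s → x s ≈ y s) → ∀ s → (v ∧ x) s ≈ (v ∧ y) s
  ∧-cong v x≈y []            = refl
  ∧-cong v x≈y (outside ∷ s) = ∧-cong (tail v) (x≈y ∘ (outside ∷_)) s
  ∧-cong v x≈y (inside ∷ s)  =
    +-cong (*-congˡ (x≈y (outside ∷ s))) (-‿cong (∧-cong (tail v) (x≈y ∘ (inside ∷_)) s))

  ∧-zeroʳ : ∀ {n} (v : Fin n → Carrier) {x : Multivector n} →
            (∀ s → x s ≈ 0#) → ∀ s → (v ∧ x) s ≈ 0#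
  ∧-zeroʳ v x≈0 []            = refl
  ∧-zeroʳ v x≈0 (outside ∷ s) = ∧-zeroʳ (tail v) (x≈0 ∘ (outside ∷_)) s
  ∧-zeroʳ v x≈0 (inside ∷ s)  =
    0-0 (trans (*-congˡ (x≈0 (outside ∷ s))) (zeroʳ _)) (∧-zeroʳ (tail v) (x≈0 ∘ (inside ∷_)) s)

  ∧-zeroˡ : ∀ {n} (v : Fin n → Carrier) (x : Multivector n) →
            (∀ j → v j ≈ 0#) → ∀ s → (v ∧ x) s ≈ 0#
  ∧-zeroˡ v x v≈0 []            = refl
  ∧-zeroˡ v x v≈0 (outside ∷ s) = ∧-zeroˡ (tail v) _ (v≈0 ∘ suc) s
  ∧-zeroˡ v x v≈0 (inside ∷ s)  =
    0-0 (trans (*-congʳ (v≈0 zero)) (zeroˡ _)) (∧-zeroˡ (tail v) _ (v≈0 ∘ suc) s)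

  -- The combination `a * x - y` is the shape of an `inside` coordinate of a wedge product, so this
  -- form of linearity is the one that expanding a double wedge calls for.
  ∧-linearʳ : ∀ {n} (v : Fin n → Carrier) a (x y : Multivector n) s →
              (v ∧ (λ t → a * x t - y t)) s ≈ a * (v ∧ x) s - (v ∧ y) s
  ∧-linearʳ v a x y []            = sym (0-0 (zeroʳ a) refl)
  ∧-linearʳ v a x y (outside ∷ s) = ∧-linearʳ (tail v) a _ _ s
  ∧-linearʳ v a x y (inside ∷ s)  = begin
    v₀ * (a * x₀ - y₀) - (tail v ∧ (λ t → a * x (inside ∷ t) - y (inside ∷ t))) s
      ≈⟨ +-cong (x[y-z]≈xy-xz v₀ _ _) (-‿cong (∧-linearʳ (tail v) a _ _ s)) ⟩
    (v₀ * (a * x₀) - v₀ * y₀) - (a * vx₁ - vy₁)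
      ≈⟨ sub-interchange _ _ _ _ ⟩
    (v₀ * (a * x₀) - a * vx₁) - (v₀ * y₀ - vy₁)
      ≈⟨ +-congʳ (+-congʳ (x*yz≈y*xz v₀ a x₀)) ⟩
    (a * (v₀ * x₀) - a * vx₁) - (v₀ * y₀ - vy₁)
      ≈⟨ +-congʳ (x[y-z]≈xy-xz a _ _) ⟨
    a * (v₀ * x₀ - vx₁) - (v₀ * y₀ - vy₁) ∎
    where
    v₀ = head v
    x₀ = x (outside ∷ s)
    y₀ = y (outside ∷ s)
    vx₁ = (tail v ∧ (x ∘ (inside ∷_))) s
    vy₁ = (tail v ∧ (y ∘ (inside ∷_))) s

  -- In the `inside` coordinate the two terms containing `head v` cancel, and what is left is the
  -- same claim for `tail v`. Anticommutativity alone would only give that twice the product is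
  -- zero.
  ∧-alternating : ∀ {n} (v : Fin n → Carrier) (x : Multivector n) s → (v ∧ v ∧ x) s ≈ 0#
  ∧-alternating v x []            = refl
  ∧-alternating v x (outside ∷ s) = ∧-alternating (tail v) _ s
  ∧-alternating v x (inside ∷ s)  = trans
    (+-congˡ (-‿cong (∧-linearʳ (tail v) (head v) _ _ s)))
    (x-[x-0]≈0 _ (∧-alternating (tail v) _ s))

  -- In the `inside` coordinate the terms `v₀ * wx` and `w₀ * vx` have opposite signs and trade
  -- places; the rest is the same claim for the tails.
  ∧-anticomm : ∀ {n} (v w : Fin n → Carrier) (x : Multivector n) s →
               (v ∧ w ∧ x) s ≈ - (w ∧ v ∧ x) s
  ∧-anticomm v w x []            = sym -0#≈0#
  ∧-anticomm v w x (outside ∷ s) = ∧-anticomm (tail v) (tail w) _ s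
  ∧-anticomm v w x (inside ∷ s)  = begin
    v₀ * wx - (tail v ∧ (λ t → w₀ * x (outside ∷ t) - (tail w ∧ (x ∘ (inside ∷_))) t)) s
      ≈⟨ +-congˡ (-‿cong (∧-linearʳ (tail v) w₀ _ _ s)) ⟩
    v₀ * wx - (w₀ * vx - vwx)
      ≈⟨ +-congˡ (⁻¹-anti-homo-// _ _) ⟩
    v₀ * wx + (vwx - w₀ * vx)
      ≈⟨ +-assoc _ _ _ ⟨
    (v₀ * wx + vwx) - w₀ * vx
      ≈⟨ +-congʳ (+-congˡ (∧-anticomm (tail v) (tail w) _ s)) ⟩
    (v₀ * wx - wvx) - w₀ * vx
      ≈⟨ ⁻¹-anti-homo-// _ _ ⟨
    - (w₀ * vx - (v₀ * wx - wvx))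
      ≈⟨ -‿cong (+-congˡ (-‿cong (∧-linearʳ (tail w) v₀ _ _ s))) ⟨
    - (w₀ * vx - (tail w ∧ (λ t → v₀ * x (outside ∷ t) - (tail v ∧ (x ∘ (inside ∷_))) t)) s) ∎
    where
    v₀ = head v
    w₀ = head w
    vx = (tail v ∧ (x ∘ (outside ∷_))) s
    wx = (tail w ∧ (x ∘ (outside ∷_))) s
    vwx = (tail v ∧ tail w ∧ (x ∘ (inside ∷_))) s
    wvx = (tail w ∧ tail v ∧ (x ∘ (inside ∷_))) s

  -- Carries a repeated row past the rows that stand between it and its copy.
  ∧-swap-zero : ∀ {n} (v w : Fin n → Carrier) (x : Multivector n) →
                (∀ s → (v ∧ x) s ≈ 0#) → ∀ s → (v ∧ w ∧ x) s ≈ 0#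
  ∧-swap-zero v w x vx≈0 s =
    trans (∧-anticomm v w x s) (trans (-‿cong (∧-zeroʳ w vx≈0 s)) -0#≈0#)

  row∧⋀≈0 : ∀ {m n} (M : Fin m → Fin n → Carrier) k s → (M k ∧ ⋀ M) s ≈ 0#
  row∧⋀≈0 M zero    s = ∧-alternating (M zero) _ s
  row∧⋀≈0 M (suc k) s = ∧-swap-zero (M (suc k)) (M zero) _ (row∧⋀≈0 (M ∘ suc) k) s

  -- Recursion on the position makes linearity in `v` structural: `v` enters once, and the rows
  -- before it are then wedged on, each a linear operation.
  ⋀-replace : ∀ {m n} → (Fin m → Fin n → Carrier) → Fin m → (Fin n → Carrier) → Multivector n
  ⋀-replace M zero    v = v ∧ ⋀ (M ∘ suc)
  ⋀-replace M (suc i) v = M zero ∧ ⋀-replace (M ∘ suc) i v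

  ⋀-replace-self : ∀ {m n} (M : Fin m → Fin n → Carrier) i s → ⋀-replace M i (M i) s ≈ ⋀ M s
  ⋀-replace-self M zero    s = refl
  ⋀-replace-self M (suc i) s = ∧-cong (M zero) (⋀-replace-self (M ∘ suc) i) s

  ∧⋀-replace≈0 : ∀ {m n} (M : Fin m → Fin n → Carrier) i v s → (v ∧ ⋀-replace M i v) s ≈ 0#
  ∧⋀-replace≈0 M zero    v s = ∧-alternating v _ s
  ∧⋀-replace≈0 M (suc i) v s = ∧-swap-zero v (M zero) _ (∧⋀-replace≈0 (M ∘ suc) i v) s

  -- The row `M k` now stands both in its own place and in place `i`. Descending to the earlier of
  -- the two leaves a wedge whose first factor occurs again further on.
  ⋀-replace-other : ∀ {m n} (M : Fin m → Fin n → Carrier) i k → k ≢ i →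
                    ∀ s → ⋀-replace M i (M k) s ≈ 0#
  ⋀-replace-other M zero    zero    k≢i s = contradiction ≡.refl k≢i
  ⋀-replace-other M zero    (suc k) k≢i s = row∧⋀≈0 (M ∘ suc) k s
  ⋀-replace-other M (suc i) zero    k≢i s = ∧⋀-replace≈0 (M ∘ suc) i (M zero) s
  ⋀-replace-other M (suc i) (suc k) k≢i s =
    ∧-zeroʳ (M zero) (⋀-replace-other (M ∘ suc) i k (k≢i ∘ ≡.cong suc)) s

  -- Linearity is expressed by exhibiting coefficients because they are the data wanted: for the `⊤`
  -- coordinate of `⋀-replace M i`, with `M` square, they are entries of the adjugate.
  LinearForm : ∀ {n} → ((Fin n → Carrier) → Carrier) → Set (c ⊔ ℓ)
  LinearForm {n} f = Σ[ a ∈ (Fin n → Carrier) ] (∀ v → f v ≈ sum (λ j → v j * a j))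

  linear-0 : ∀ {n} → LinearForm {n} (λ v → 0#)
  linear-0 = (λ j → 0#) , λ v → sym (sum-zero _ (λ j → zeroʳ (v j)))

  linear-scale : ∀ {n} a {f : (Fin n → Carrier) → Carrier} →
                 LinearForm f → LinearForm (λ v → a * f v)
  linear-scale a {f} (b , f≈) = (λ j → a * b j) , λ v → begin
    a * f v                      ≈⟨ *-congˡ (f≈ v) ⟩
    a * sum (λ j → v j * b j)    ≈⟨ *-distribˡ-sum a (λ j → v j * b j) ⟩
    sum (λ j → a * (v j * b j))  ≈⟨ sum-cong-≋ (λ j → x*yz≈y*xz a (v j) (b j)) ⟩
    sum (λ j → v j * (a * b j))  ∎

  linear-sub : ∀ {n} {f g : (Fin n → Carrier) → Carrier} →
               LinearForm f → LinearForm g → LinearForm (λ v → f v - g v)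
  linear-sub {_} {f} {g} (a , f≈) (b , g≈) = (λ j → a j - b j) , λ v → begin
    f v - g v                                              ≈⟨ +-cong (f≈ v) (-‿cong (g≈ v)) ⟩
    sum (λ j → v j * a j) - sum (λ j → v j * b j)          ≈⟨ +-congˡ (sum-neg (λ j → v j * b j)) ⟨
    sum (λ j → v j * a j) + sum (λ j → - (v j * b j))      ≈⟨ ∑-distrib-+ (λ j → v j * a j) _ ⟨
    sum (λ j → v j * a j - v j * b j)                      ≈⟨ sum-cong-≋ (λ j → x[y-z]≈xy-xz (v j) (a j) (b j)) ⟨
    sum (λ j → v j * (a j - b j))                          ∎

  linear-head : ∀ {n} a → LinearForm {suc n} (λ v → head v * a)
  linear-head a = (λ { zero → a ; (suc j) → 0# }) , λ v →
    sym (trans (+-congˡ (sum-zero _ (λ j → zeroʳ (v (suc j))))) (+-identityʳ _))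

  linear-tail : ∀ {n} {f : (Fin n → Carrier) → Carrier} →
                LinearForm f → LinearForm (λ v → f (tail v))
  linear-tail (a , f≈) = (λ { zero → 0# ; (suc j) → a j }) , λ v →
    trans (f≈ (tail v)) (sym (trans (+-congʳ (zeroʳ (v zero))) (+-identityˡ _)))

  ∧-linearFormˡ : ∀ {n} (x : Multivector n) s → LinearForm (λ v → (v ∧ x) s)
  ∧-linearFormˡ x []            = linear-0
  ∧-linearFormˡ x (outside ∷ s) = linear-tail (∧-linearFormˡ _ s)
  ∧-linearFormˡ x (inside ∷ s)  = linear-sub (linear-head _) (linear-tail (∧-linearFormˡ _ s))

  ∧-linearFormʳ : ∀ {k n} (w : Fin n → Carrier) {y : (Fin k → Carrier) → Multivector n} →
                  (∀ s → LinearForm (λ v → y v s)) → ∀ s → LinearForm (λ v → (w ∧ y v) s)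
  ∧-linearFormʳ w y-linear []            = linear-0
  ∧-linearFormʳ w y-linear (outside ∷ s) = ∧-linearFormʳ (tail w) (y-linear ∘ (outside ∷_)) s
  ∧-linearFormʳ w y-linear (inside ∷ s)  = linear-sub
    (linear-scale (head w) (y-linear (outside ∷ s)))
    (∧-linearFormʳ (tail w) (y-linear ∘ (inside ∷_)) s)

  ⋀-replace-linear : ∀ {m n} (M : Fin m → Fin n → Carrier) i s →
                     LinearForm (λ v → ⋀-replace M i v s)
  ⋀-replace-linear M zero    s = ∧-linearFormˡ _ s
  ⋀-replace-linear M (suc i) s = ∧-linearFormʳ (M zero) (⋀-replace-linear (M ∘ suc) i) s

  -- For a square matrix and s = ⊤, the vector a is the i-th column of the adjugate.
  cramer : ∀ {m n} (M : Fin m → Fin n → Carrier) s i → Σ[ a ∈ (Fin n → Carrier) ]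
           sum (λ j → M i j * a j) ≈ ⋀ M s × (∀ k → k ≢ i → sum (λ j → M k j * a j) ≈ 0#)
  cramer M s i with ⋀-replace-linear M i s
  ... | a , f≈ = a
    , trans (sym (f≈ (M i))) (⋀-replace-self M i s)
    , λ k k≢i → trans (sym (f≈ (M k))) (⋀-replace-other M i k k≢i s)

  -- Sending the first basis vector to zero is a homomorphism of exterior algebras, and coordinates
  -- without that vector see only the image of each row.
  ⋀-outside : ∀ {m n} (M : Fin m → Fin (suc n) → Carrier) s →
              ⋀ M (outside ∷ s) ≈ ⋀ (tail ∘ M) s
  ⋀-outside {zero}  M s = refl
  ⋀-outside {suc m} M s = ∧-cong (tail (M zero)) (⋀-outside (M ∘ suc)) s

  -- Expansion along the first row: its tail is zero, so only the diagonal term survives, and in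
  -- that term the first column of the remaining rows is invisible.
  det-1ₘ : ∀ n → ⋀ (1ₘ {n}) ⊤ ≈ 1#
  det-1ₘ zero    = refl
  det-1ₘ (suc n) = begin
    1# * ⋀ rows (outside ∷ ⊤ {n}) - (tail (1ₘ {suc n} zero) ∧ (⋀ rows ∘ (inside ∷_))) (⊤ {n})
      ≈⟨ +-cong (*-identityˡ _) (-‿cong (∧-zeroˡ {n} (λ _ → 0#) _ (λ _ → refl) ⊤)) ⟩
    ⋀ rows (outside ∷ ⊤ {n}) - 0#
      ≈⟨ x-0≈x _ ⟩
    ⋀ rows (outside ∷ ⊤ {n})
      ≈⟨ ⋀-outside rows ⊤ ⟩
    ⋀ (1ₘ {n}) ⊤
      ≈⟨ det-1ₘ n ⟩
    1# ∎
    where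
    rows : Fin n → Fin (suc n) → Carrier
    rows = 1ₘ ∘ suc

-- Sequences under the shift, and linear recurrences.

module LinearRecurrences {c ℓ} (R : CommutativeRing c ℓ) where
  open CommutativeRing R hiding (zero)
  open RingProperties ring using (-0#≈0#; -‿distribˡ-*)
  open CommutativeSemigroupProperties +-commutativeSemigroup using (interchange)
  open CommutativeSemigroupProperties *-commutativeSemigroup using (x∙yz≈y∙xz)
  open SetoidReasoning setoid
  open Univariate rawRing hiding (rawRing)
  open PolynomialRing R
  open Matrices rawRing using (Matrix; 1ₘ; _^ₘ_)
  open Sums R
  private
    module Λ    = Exterior R
    module Λ[X] = Exterior commutativeRing

  -- R[X] acts on sequences, X being the shift: act p f m is the m-th term of p f.
  act : List Carrier → (ℕ → Carrier) → ℕ → Carrier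
  act []      f m = 0#
  act (a ∷ p) f m = a * f m + act p f (suc m)

  act-≈[] : ∀ p f m → p ≈ₚ [] → act p f m ≈ 0#
  act-≈[] []      f m p≈0 = refl
  act-≈[] (a ∷ p) f m p≈0 = begin
    a * f m + act p f (suc m)  ≈⟨ +-cong (*-congʳ (p≈0 0)) (act-≈[] p f (suc m) (p≈0 ∘ suc)) ⟩
    0# * f m + 0#              ≈⟨ +-identityʳ _ ⟩
    0# * f m                   ≈⟨ zeroˡ _ ⟩
    0#                         ∎

  -- Equal polynomials may be lists of different lengths; the surplus of the longer list represents
  -- zero and falls to `act-≈[]`.
  act-cong : ∀ p q f m → p ≈ₚ q → act p f m ≈ act q f m
  act-cong []      q       f m p≈q = sym (act-≈[] q f m (λ i → sym (p≈q i)))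
  act-cong (a ∷ p) []      f m p≈q = act-≈[] (a ∷ p) f m p≈q
  act-cong (a ∷ p) (b ∷ q) f m p≈q =
    +-cong (*-congʳ (p≈q 0)) (act-cong p q f (suc m) (p≈q ∘ suc))

  act-zeroʳ : ∀ p m {f} → (∀ k → f k ≈ 0#) → act p f m ≈ 0#
  act-zeroʳ []      m f≈0 = refl
  act-zeroʳ (a ∷ p) m f≈0 =
    trans (+-cong (trans (*-congˡ (f≈0 m)) (zeroʳ a)) (act-zeroʳ p (suc m) f≈0)) (+-identityʳ _)

  act-+ₚ : ∀ p q f m → act (p +ₚ q) f m ≈ act p f m + act q f m
  act-+ₚ []      q       f m = sym (+-identityˡ _)
  act-+ₚ (a ∷ p) []      f m = sym (+-identityʳ _)
  act-+ₚ (a ∷ p) (b ∷ q) f m =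
    trans (+-cong (distribʳ _ a b) (act-+ₚ p q f (suc m))) (interchange _ _ _ _)

  act-scaleˡ : ∀ a p f m → act (map (a *_) p) f m ≈ a * act p f m
  act-scaleˡ a []      f m = sym (zeroʳ a)
  act-scaleˡ a (b ∷ p) f m =
    trans (+-cong (*-assoc a b _) (act-scaleˡ a p f (suc m))) (sym (distribˡ a _ _))

  -- With additivity, this makes sequences a module over R[X], so that matrices of polynomials can
  -- be applied to vectors of sequences.
  act-*ₚ : ∀ p q f m → act (p *ₚ q) f m ≈ act p (act q f) m
  act-*ₚ []      q f m = refl
  act-*ₚ (a ∷ p) q f m = begin
    act (map (a *_) q +ₚ (0# ∷ p *ₚ q)) f m                         ≈⟨ act-+ₚ (map (a *_) q) _ f m ⟩
    act (map (a *_) q) f m + (0# * f m + act (p *ₚ q) f (suc m))    ≈⟨ +-cong (act-scaleˡ a q f m) (+-cong (zeroˡ _) (act-*ₚ p q f (suc m))) ⟩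
    a * act q f m + (0# + act p (act q f) (suc m))                  ≈⟨ +-congˡ (+-identityˡ _) ⟩
    a * act q f m + act p (act q f) (suc m)                         ∎

  act-scaleʳ : ∀ p a f m → act p (λ k → a * f k) m ≈ a * act p f m
  act-scaleʳ []      a f m = sym (zeroʳ a)
  act-scaleʳ (b ∷ p) a f m =
    trans (+-cong (x∙yz≈y∙xz b a _) (act-scaleʳ p a f (suc m))) (sym (distribˡ a _ _))

  act-sumʳ : ∀ {n} p (f : Fin n → ℕ → Carrier) m →
             act p (λ k → sum (λ j → f j k)) m ≈ sum (λ j → act p (f j) m)
  act-sumʳ {n} []      f m = sym (sum-replicate-zero n)
  act-sumʳ     (a ∷ p) f m = trans
    (+-cong (*-distribˡ-sum a (λ j → f j m)) (act-sumʳ p f (suc m)))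
    (sym (∑-distrib-+ (λ j → a * f j m) _))

  act-sumˡ : ∀ {n} (p : Fin n → List Carrier) f m →
             act (Sums.sum commutativeRing p) f m ≈ sum (λ j → act (p j) f m)
  act-sumˡ {zero}  p f m = refl
  act-sumˡ {suc n} p f m = trans (act-+ₚ (p zero) _ f m) (+-congˡ (act-sumˡ (p ∘ suc) f m))

  -- Below degree `n` the terms of `f` vanish, above it the coefficients of `p` do.
  act-leading : ∀ n p f m → (∀ i → coeff p (suc (n ℕ.+ i)) ≈ 0#) →
                (∀ i → i < n → f (i ℕ.+ m) ≈ 0#) → act p f m ≈ coeff p n * f (n ℕ.+ m)
  act-leading n       []      f m high≈0 f≈0 = sym (zeroˡ _)
  act-leading zero    (a ∷ p) f m high≈0 f≈0 =
    trans (+-congˡ (act-≈[] p f (suc m) high≈0)) (+-identityʳ _)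
  act-leading (suc n) (a ∷ p) f m high≈0 f≈0 = begin
    a * f m + act p f (suc m)           ≈⟨ +-cong (trans (*-congˡ (f≈0 0 ℕ.z<s)) (zeroʳ a)) (act-leading n p f (suc m) high≈0 f≈0′) ⟩
    0# + coeff p n * f (n ℕ.+ suc m)    ≈⟨ +-identityˡ _ ⟩
    coeff p n * f (n ℕ.+ suc m)         ≡⟨ ≡.cong (λ k → coeff p n * f k) (ℕ.+-suc n m) ⟩
    coeff p n * f (suc n ℕ.+ m)         ∎
    where
    f≈0′ : ∀ i → i < n → f (i ℕ.+ suc m) ≈ 0#
    f≈0′ i i<n = trans (reflexive (≡.cong f (ℕ.+-suc i m))) (f≈0 (suc i) (ℕ.s<s i<n))

  recurrence-zero : ∀ n p f → coeff p n ≈ 1# → (∀ i → coeff p (suc (n ℕ.+ i)) ≈ 0#) →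
                    (∀ m → act p f m ≈ 0#) → (∀ i → i < n → f i ≈ 0#) → ∀ m → f m ≈ 0#
  recurrence-zero n p f monic high≈0 pf≈0 initial m =
    window (suc m) m (ℕ.m≤m+n (suc m) n)
    where
    -- The window of known zeros grows by one index at a time: its next term `f (m + n)` is the
    -- leading term of `act p f m`, whose other terms vanish.
    window : ∀ m i → i < m ℕ.+ n → f i ≈ 0#
    window zero    i i<n   = initial i i<n
    window (suc m) i i<m+n with ℕ.m<1+n⇒m<n∨m≡n i<m+n
    ... | inj₁ i<m = window m i i<m
    ... | inj₂ ≡.refl = begin
      f (m ℕ.+ n)                  ≡⟨ ≡.cong f (ℕ.+-comm m n) ⟩
      f (n ℕ.+ m)                  ≈⟨ *-identityˡ _ ⟨
      1# * f (n ℕ.+ m)             ≈⟨ *-congʳ monic ⟨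
      coeff p n * f (n ℕ.+ m)      ≈⟨ act-leading n p f m high≈0 f≈0 ⟨
      act p f m                    ≈⟨ pf≈0 m ⟩
      0#                           ∎
      where
      f≈0 : ∀ j → j < n → f (j ℕ.+ m) ≈ 0#
      f≈0 j j<n = window m (j ℕ.+ m) (≡.subst (j ℕ.+ m <_) (ℕ.+-comm n m) (ℕ.+-monoˡ-< m j<n))

  -- B + X C
  pencil : ∀ {m n} (B C : Fin m → Fin n → Carrier) → Fin m → Fin n → List Carrier
  pencil B C i j = B i j ∷ C i j ∷ []

  coeff-pencil* : ∀ b a q i → coeff q (suc i) ≈ 0# →
                  coeff ((b ∷ a ∷ []) *ₚ q) (suc i) ≈ a * coeff q i
  coeff-pencil* b a q i q≈0 = begin
    coeff ((b ∷ a ∷ []) *ₚ q) (suc i)               ≈⟨ coeff-∷*-suc b (a ∷ []) q i ⟩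
    b * coeff q (suc i) + coeff ((a ∷ []) *ₚ q) i   ≈⟨ +-cong (trans (*-congˡ q≈0) (zeroʳ b)) (coeff-+ (map (a *_) q) _ i) ⟩
    0# + (coeff (map (a *_) q) i + coeff (0# ∷ []) i) ≈⟨ +-identityˡ _ ⟩
    coeff (map (a *_) q) i + coeff (0# ∷ []) i      ≈⟨ +-cong (coeff-scale a q i) (0∷[]≈[] i) ⟩
    a * coeff q i + 0#                              ≈⟨ +-identityʳ _ ⟩
    a * coeff q i                                   ∎

  -- With nothing in degree `suc i` of `x`, the constant parts `b` cannot contribute there. Iterated
  -- over the rows, this bounds the degree of a wedge and identifies its leading coefficient.
  coeff-pencil∧ : ∀ {n} (b a : Fin n → Carrier) (x : Λ[X].Multivector n) i →
    (∀ s → coeff (x s) (suc i) ≈ 0#) → ∀ s →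
    coeff (((λ j → b j ∷ a j ∷ []) Λ[X].∧ x) s) (suc i) ≈ (a Λ.∧ (λ t → coeff (x t) i)) s
  coeff-pencil∧ b a x i x≈0 []            = refl
  coeff-pencil∧ b a x i x≈0 (outside ∷ s) = coeff-pencil∧ (tail b) (tail a) _ i (x≈0 ∘ (outside ∷_)) s
  coeff-pencil∧ b a x i x≈0 (inside ∷ s)  = begin
    coeff (v₀x₀ +ₚ map (-_) v′x₁) (suc i)                ≈⟨ coeff-+ v₀x₀ _ (suc i) ⟩
    coeff v₀x₀ (suc i) + coeff (map (-_) v′x₁) (suc i)   ≈⟨ +-cong (coeff-pencil* _ _ (x (outside ∷ s)) i (x≈0 (outside ∷ s))) (coeff-neg v′x₁ (suc i)) ⟩
    head a * coeff (x (outside ∷ s)) i - coeff v′x₁ (suc i) ≈⟨ +-congˡ (-‿cong (coeff-pencil∧ (tail b) (tail a) _ i (x≈0 ∘ (inside ∷_)) s)) ⟩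
    (a Λ.∧ (λ t → coeff (x t) i)) (inside ∷ s) ∎
    where
    v₀x₀ v′x₁ : List Carrier
    v₀x₀ = (head b ∷ head a ∷ []) *ₚ x (outside ∷ s)
    v′x₁ = ((λ j → tail b j ∷ tail a j ∷ []) Λ[X].∧ (x ∘ (inside ∷_))) s

  coeff-unit : ∀ {n} (s : Subset n) → coeff (Λ[X].unit s) 0 ≈ Λ.unit s
  coeff-unit []            = refl
  coeff-unit (outside ∷ s) = coeff-unit s
  coeff-unit (inside ∷ s)  = refl

  coeff-unit-high : ∀ {n} i (s : Subset n) → coeff (Λ[X].unit s) (suc i) ≈ 0#
  coeff-unit-high i []            = refl
  coeff-unit-high i (outside ∷ s) = coeff-unit-high i s
  coeff-unit-high i (inside ∷ s)  = refl

  -- Each of the `m` rows has degree at most one, so their wedge has degree at most `m`.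
  coeff-⋀-high : ∀ {m n} (B C : Fin m → Fin n → Carrier) i s →
                 coeff (Λ[X].⋀ (pencil B C) s) (suc (m ℕ.+ i)) ≈ 0#
  coeff-⋀-high {zero}  B C i s = coeff-unit-high i s
  coeff-⋀-high {suc m} B C i s = trans
    (coeff-pencil∧ (B zero) (C zero) _ (suc (m ℕ.+ i)) next s)
    (Λ.∧-zeroʳ (C zero) (coeff-⋀-high (B ∘ suc) (C ∘ suc) i) s)
    where
    next : ∀ t → coeff (Λ[X].⋀ (pencil (B ∘ suc) (C ∘ suc)) t) (suc (suc (m ℕ.+ i))) ≈ 0#
    next t = ≡.subst (λ k → coeff (Λ[X].⋀ (pencil (B ∘ suc) (C ∘ suc)) t) (suc k) ≈ 0#)
      (ℕ.+-suc m i) (coeff-⋀-high (B ∘ suc) (C ∘ suc) (suc i) t)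

  -- Degree `m` is reached only by taking the X-term of every row. With `C` the identity this makes
  -- the characteristic polynomial monic.
  coeff-⋀-leading : ∀ {m n} (B C : Fin m → Fin n → Carrier) s →
                    coeff (Λ[X].⋀ (pencil B C) s) m ≈ Λ.⋀ C s
  coeff-⋀-leading {zero}  B C s = coeff-unit s
  coeff-⋀-leading {suc m} B C s = trans
    (coeff-pencil∧ (B zero) (C zero) _ m next s)
    (Λ.∧-cong (C zero) (coeff-⋀-leading (B ∘ suc) (C ∘ suc)) s)
    where
    next : ∀ t → coeff (Λ[X].⋀ (pencil (B ∘ suc) (C ∘ suc)) t) (suc m) ≈ 0#
    next t = ≡.subst (λ k → coeff (Λ[X].⋀ (pencil (B ∘ suc) (C ∘ suc)) t) (suc k) ≈ 0#)
      (ℕ.+-identityʳ m) (coeff-⋀-high (B ∘ suc) (C ∘ suc) 0 t)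

  -- The Cayley-Hamilton theorem for sequences of entries of powers.

  module CayleyHamilton {n} (A : Matrix n) where

    -- X - Aᵀ
    M : Fin n → Fin n → List Carrier
    M = pencil (λ j k → - A k j) 1ₘ

    charPoly : List Carrier
    charPoly = Λ[X].⋀ M ⊤

    charPoly-monic : coeff charPoly n ≈ 1#
    charPoly-monic = trans (coeff-⋀-leading (λ j k → - A k j) 1ₘ ⊤) (Λ.det-1ₘ n)

    charPoly-degree : ∀ i → coeff charPoly (suc (n ℕ.+ i)) ≈ 0#
    charPoly-degree i = coeff-⋀-high (λ j k → - A k j) 1ₘ i ⊤

    entry : Fin n → Fin n → ℕ → Carrier
    entry i l m = (A ^ₘ m) i l

    -- This is row `k` of `A ^ₘ suc m = A *ₘ (A ^ₘ m)` with X read as the shift. The sum runs over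
    -- the row index of `M`, whence the transpose in its definition.
    M-kills-column : ∀ l k m → sum (λ j → act (M j k) (entry j l) m) ≈ 0#
    M-kills-column l k m = begin
      sum (λ j → - A k j * entry j l m + (1ₘ j k * entry j l (suc m) + 0#))
        ≈⟨ ∑-distrib-+ (λ j → - A k j * entry j l m) _ ⟩
      sum (λ j → - A k j * entry j l m) + sum (λ j → 1ₘ j k * entry j l (suc m) + 0#)
        ≈⟨ +-cong negated diagonal ⟩
      - entry k l (suc m) + entry k l (suc m)
        ≈⟨ -‿inverseˡ _ ⟩
      0# ∎
      where
      negated : sum (λ j → - A k j * entry j l m) ≈ - entry k l (suc m)
      negated = trans
        (sum-cong-≋ (λ j → sym (-‿distribˡ-* (A k j) (entry j l m))))
        (sum-neg (λ j → A k j * entry j l m))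

      diagonal : sum (λ j → 1ₘ j k * entry j l (suc m) + 0#) ≈ entry k l (suc m)
      diagonal = begin
        sum (λ j → 1ₘ j k * entry j l (suc m) + 0#)
          ≈⟨ sum-single _ k (λ j j≢k → trans (+-identityʳ _) (trans (*-congʳ (1ₘ-offDiagonal j k j≢k)) (zeroˡ _))) ⟩
        1ₘ k k * entry k l (suc m) + 0#
          ≈⟨ trans (+-identityʳ _) (*-congʳ (1ₘ-diagonal k)) ⟩
        1# * entry k l (suc m)
          ≈⟨ *-identityˡ _ ⟩
        entry k l (suc m) ∎

    -- The adjugate argument: pairing `a` with row `j` of `M` gives `charPoly` for `j = i` and zero
    -- otherwise. So the left side is a double sum over `j` and `k`, and summing over `j` first
    -- gives zero by `M-kills-column`.
    charPoly-kills-entry : ∀ i l m → act charPoly (entry i l) m ≈ 0#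
    charPoly-kills-entry i l m with Λ[X].cramer M ⊤ i
    ... | a , row-i , other-rows = begin
      act charPoly (entry i l) m
        ≈⟨ act-cong (Sums.sum commutativeRing (λ k → M i k *ₚ a k)) charPoly (entry i l) m row-i ⟨
      act (Sums.sum commutativeRing (λ k → M i k *ₚ a k)) (entry i l) m
        ≈⟨ sum-single (λ j → act (Sums.sum commutativeRing (λ k → M j k *ₚ a k)) (entry j l) m) i
             (λ j j≢i → act-≈[] (Sums.sum commutativeRing (λ k → M j k *ₚ a k)) _ m (other-rows j j≢i)) ⟨
      sum (λ j → act (Sums.sum commutativeRing (λ k → M j k *ₚ a k)) (entry j l) m)
        ≈⟨ sum-cong-≋ (λ j → trans
             (act-sumˡ (λ k → M j k *ₚ a k) (entry j l) m)
             (sum-cong-≋ (λ k → trans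
               -- The factors are exchanged so that `M j k` acts on the sequence first and `a k` can
               -- later be pulled out of the sum over `j`.
               (act-cong (M j k *ₚ a k) (a k *ₚ M j k) (entry j l) m (*ₚ-comm (M j k) (a k)))
               (act-*ₚ (a k) (M j k) (entry j l) m)))) ⟩
      sum (λ j → sum (λ k → act (a k) (act (M j k) (entry j l)) m))
        ≈⟨ ∑-comm (λ j k → act (a k) (act (M j k) (entry j l)) m) ⟩
      sum (λ k → sum (λ j → act (a k) (act (M j k) (entry j l)) m))
        ≈⟨ sum-zero _ (λ k → trans
             (sym (act-sumʳ (a k) (λ j → act (M j k) (entry j l)) m))
             (act-zeroʳ (a k) m (M-kills-column l k))) ⟩
      0# ∎

    -- The recurrence given by `charPoly` is linear and the same at every position, so it passes to
    -- the combination.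
    combination-zero : ∀ {r} (q : Fin r → Carrier) (S : Fin r → Fin n × Fin n) →
      let f = λ m → sum (λ k → q k * entry (proj₁ (S k)) (proj₂ (S k)) m) in
      (∀ m → m < n → f m ≈ 0#) → ∀ m → f m ≈ 0#
    combination-zero q S =
      recurrence-zero n charPoly _ charPoly-monic charPoly-degree λ m → trans
        (act-sumʳ charPoly (λ k t → q k * entry (proj₁ (S k)) (proj₂ (S k)) t) m)
        (sum-zero _ (λ k → trans
          (act-scaleʳ charPoly (q k) (entry (proj₁ (S k)) (proj₂ (S k))) m)
          (trans (*-congˡ (charPoly-kills-entry _ _ m)) (zeroʳ _))))

-- Integral domains with decidable zero, and polynomial rings over `ℚ` as instances.

record IsDecidableDomain (R : RawRing 0ℓ 0ℓ) : Set where
  open RawRing R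
  field
    isCommutativeRing : IsCommutativeRing _≈_ _+_ _*_ -_ 0# 1#
    1≉0               : 1# ≉ 0#
    -- This is what makes the search for a pivot in elimination effective.
    zero?             : ∀ x → Dec (x ≈ 0#)
    zeroProduct       : ∀ x y → x * y ≈ 0# → x ≈ 0# ⊎ y ≈ 0#

  commutativeRing : CommutativeRing 0ℓ 0ℓ
  commutativeRing = record { isCommutativeRing = isCommutativeRing }

ℚ-isDecidableDomain : IsDecidableDomain ℚ.+-*-rawRing
ℚ-isDecidableDomain = record
  { isCommutativeRing = CommutativeRing.isCommutativeRing ℚ.+-*-commutativeRing
  ; 1≉0               = λ ()
  ; zero?             = ℚ._≟ 0ℚ
  ; zeroProduct       = zeroProduct
  }
  where
  open ≡.≡-Reasoning
  zeroProduct : ∀ x y → x ℚ.* y ≡ 0ℚ → x ≡ 0ℚ ⊎ y ≡ 0ℚ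
  zeroProduct x y xy≡0 with x ℚ.≟ 0ℚ
  ... | yes x≡0 = inj₁ x≡0
  ... | no  x≢0 = inj₂ (begin
    y                      ≡⟨ ℚ.*-identityˡ y ⟨
    ℚ.1ℚ ℚ.* y             ≡⟨ ≡.cong (ℚ._* y) (ℚ.*-inverseˡ x) ⟨
    (ℚ.1/ x) ℚ.* x ℚ.* y   ≡⟨ ℚ.*-assoc (ℚ.1/ x) x y ⟩
    (ℚ.1/ x) ℚ.* (x ℚ.* y) ≡⟨ ≡.cong ((ℚ.1/ x) ℚ.*_) xy≡0 ⟩
    (ℚ.1/ x) ℚ.* 0ℚ        ≡⟨ ℚ.*-zeroʳ (ℚ.1/ x) ⟩
    0ℚ                     ∎)
    where instance _ = ℚ.≢-nonZero x≢0

polynomial-isDecidableDomain : ∀ {R} → IsDecidableDomain R → IsDecidableDomain (Univariate.rawRing R)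
polynomial-isDecidableDomain {R} R-domain = record
  { isCommutativeRing = isCommutativeRingₚ
  ; 1≉0               = λ 1≈0 → 1≉0 (1≈0 0)
  ; zero?             = zeroₚ?
  ; zeroProduct       = zeroProductₚ
  }
  where
  open IsDecidableDomain R-domain
  open CommutativeRing commutativeRing hiding (zero; isCommutativeRing)
  open Univariate rawRing hiding (rawRing)
  open PolynomialRing commutativeRing hiding (commutativeRing)
  open SetoidReasoning setoid

  ∷≈[] : ∀ {a p} → a ≈ 0# → p ≈ₚ [] → a ∷ p ≈ₚ []
  ∷≈[] a≈0 p≈0 zero    = a≈0
  ∷≈[] a≈0 p≈0 (suc i) = p≈0 i

  zeroₚ? : ∀ p → Dec (p ≈ₚ [])
  zeroₚ? []      = yes λ i → refl
  zeroₚ? (a ∷ p) with zero? a | zeroₚ? p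
  ... | yes a≈0 | yes p≈0 = yes (∷≈[] a≈0 p≈0)
  ... | no  a≉0 | _       = no λ ap≈0 → a≉0 (ap≈0 0)
  ... | _       | no  p≉0 = no λ ap≈0 → p≉0 (ap≈0 ∘ suc)

  -- If a constant coefficient vanishes, divide by X; otherwise the product has a
  -- nonzero constant coefficient.
  zeroProductₚ : ∀ p q → p *ₚ q ≈ₚ [] → p ≈ₚ [] ⊎ q ≈ₚ []
  zeroProductₚ []      q       pq≈0 = inj₁ λ i → refl
  zeroProductₚ (a ∷ p) []      pq≈0 = inj₂ λ i → refl
  zeroProductₚ P@(a ∷ p) Q@(b ∷ q) PQ≈0 =
    [ (λ a≈0 → [ inj₁ ∘ ∷≈[] a≈0 , inj₂ ]′ (zeroProductₚ p Q (divide-left a≈0)))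
    , (λ b≈0 → [ inj₁ , inj₂ ∘ ∷≈[] b≈0 ]′ (zeroProductₚ P q (divide-right b≈0)))
    ]′ (zeroProduct a b (trans (sym (coeff-∷*-zero a p Q)) (PQ≈0 0)))
    where
    divide-left : a ≈ 0# → p *ₚ Q ≈ₚ []
    divide-left a≈0 i = begin
      coeff (p *ₚ Q) i                      ≈⟨ +-identityˡ _ ⟨
      0# + coeff (p *ₚ Q) i                 ≈⟨ +-congʳ (trans (*-congʳ a≈0) (zeroˡ _)) ⟨
      a * coeff q i + coeff (p *ₚ Q) i      ≈⟨ coeff-∷*-suc a p Q i ⟨
      coeff (P *ₚ Q) (suc i)                ≈⟨ PQ≈0 (suc i) ⟩
      0#                                    ∎

    divide-right : b ≈ 0# → P *ₚ q ≈ₚ []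
    divide-right b≈0 i = begin
      coeff (P *ₚ q) i                      ≈⟨ +-identityˡ _ ⟨
      0# + coeff (P *ₚ q) i                 ≈⟨ +-congʳ (trans (*-congˡ b≈0) (zeroʳ _)) ⟨
      coeff p i * b + coeff (P *ₚ q) i      ≈⟨ coeff-*∷-suc P b q i ⟨
      coeff (P *ₚ Q) (suc i)                ≈⟨ PQ≈0 (suc i) ⟩
      0#                                    ∎

ℚ[_]-isDecidableDomain : ∀ k → IsDecidableDomain ℚ[ k ]
ℚ[ zero  ]-isDecidableDomain = ℚ-isDecidableDomain
ℚ[ suc k ]-isDecidableDomain = polynomial-isDecidableDomain ℚ[ k ]-isDecidableDomain

-- Homogeneous linear systems over a domain.

module LinearSystems {R : RawRing 0ℓ 0ℓ} (R-domain : IsDecidableDomain R) where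
  open IsDecidableDomain R-domain
  open CommutativeRing commutativeRing hiding (zero; isCommutativeRing)
  open RingProperties ring using (-‿distribˡ-*; x[y-z]≈xy-xz)
  open CommutativeSemigroupProperties *-commutativeSemigroup using (x∙yz≈y∙xz; x∙yz≈yx∙z)
  open SetoidReasoning setoid
  open Sums commutativeRing

  -- Fraction-free elimination: row i clears the first column of the other rows.
  nontrivialSolution : ∀ k (W : Fin k → Fin (suc k) → Carrier) →
    Σ[ q ∈ (Fin (suc k) → Carrier) ]
      (∃[ j ] q j ≉ 0#) × (∀ r → sum (λ j → q j * W r j) ≈ 0#)
  nontrivialSolution zero    W = (λ _ → 1#) , (zero , 1≉0) , λ ()
  nontrivialSolution (suc k) W with any? (λ i → ¬? (zero? (W i zero)))
  -- If the first column is zero, the first unknown is free. Decidability turns the failed search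
  -- into actual vanishing.
  ... | no noPivot = e₀ , (zero , 1≉0) , λ r → trans
    (sum-single (λ j → e₀ j * W r j) zero
      (λ { zero j≢0 → contradiction ≡.refl j≢0 ; (suc j) _ → zeroˡ _ }))
    (trans (*-identityˡ _) (decidable-stable (zero? (W r zero)) (λ W≉0 → noPivot (r , W≉0))))
    where
    e₀ : Fin (suc (suc k)) → Carrier
    e₀ zero    = 1#
    e₀ (suc j) = 0#
  ... | yes (i , pivot≉0) = q , (suc j₀ , qj₀≉0) , solves
    where
    pivot : Carrier
    pivot = W i zero

    W′ : Fin (suc k) → Fin (suc k) → Carrier
    W′ r j = pivot * W r (suc j) - W r zero * W i (suc j)

    -- Row `i` of `W′` is zero, so omitting it leaves `k` equations in `suc k` unknowns and loses
    -- none.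
    reduced = nontrivialSolution k (W′ ∘ punchIn i)
    q′ = proj₁ reduced
    j₀ = proj₁ (proj₁ (proj₂ reduced))

    σ : Carrier
    σ = sum (λ j → q′ j * W i (suc j))

    q : Fin (suc (suc k)) → Carrier
    -- Back substitution without division: once the other unknowns are multiplied by `pivot`, row
    -- `i` forces this value on the first one.
    q zero    = - σ
    q (suc j) = pivot * q′ j

    qj₀≉0 : pivot * q′ j₀ ≉ 0#
    qj₀≉0 pq≈0 = [ pivot≉0 , proj₂ (proj₁ (proj₂ reduced)) ]′ (zeroProduct pivot (q′ j₀) pq≈0)

    -- The first unknown `- σ` supplies exactly the terms by which `W′ r` differs from `pivot` times
    -- `W r` on the remaining columns.
    row : ∀ r → sum (λ j → q j * W r j) ≈ sum (λ j → q′ j * W′ r j)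
    row r = begin
      - σ * w + sum (λ j → (pivot * q′ j) * W r (suc j))
        ≈⟨ +-comm _ _ ⟩
      sum (λ j → (pivot * q′ j) * W r (suc j)) + - σ * w
        ≈⟨ +-congˡ {sum (λ j → (pivot * q′ j) * W r (suc j))} clear ⟩
      sum (λ j → (pivot * q′ j) * W r (suc j)) + sum (λ j → - (w * (q′ j * W i (suc j))))
        ≈⟨ ∑-distrib-+ (λ j → (pivot * q′ j) * W r (suc j)) (λ j → - (w * (q′ j * W i (suc j)))) ⟨
      sum (λ j → (pivot * q′ j) * W r (suc j) - w * (q′ j * W i (suc j)))
        ≈⟨ sum-cong-≋ (λ j → +-cong (x∙yz≈yx∙z (q′ j) pivot (W r (suc j))) (-‿cong (x∙yz≈y∙xz (q′ j) w (W i (suc j))))) ⟨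
      sum (λ j → q′ j * (pivot * W r (suc j)) - q′ j * (w * W i (suc j)))
        ≈⟨ sum-cong-≋ (λ j → x[y-z]≈xy-xz (q′ j) (pivot * W r (suc j)) (w * W i (suc j))) ⟨
      sum (λ j → q′ j * W′ r j) ∎
      where
      w : Carrier
      w = W r zero

      clear : - σ * w ≈ sum (λ j → - (w * (q′ j * W i (suc j))))
      clear = begin
        - σ * w                                      ≈⟨ -‿distribˡ-* σ w ⟨
        - (σ * w)                                    ≈⟨ -‿cong (*-comm σ w) ⟩
        - (w * σ)                                    ≈⟨ -‿cong (*-distribˡ-sum w (λ j → q′ j * W i (suc j))) ⟩
        - sum (λ j → w * (q′ j * W i (suc j)))       ≈⟨ sum-neg (λ j → w * (q′ j * W i (suc j))) ⟨
        sum (λ j → - (w * (q′ j * W i (suc j))))     ∎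

    solves : ∀ r → sum (λ j → q j * W r j) ≈ 0#
    solves r with i ≟ r
    ... | yes ≡.refl = trans (row i) (sum-zero (λ j → q′ j * W′ i j) (λ j → trans (*-congˡ (-‿inverseʳ (pivot * W i (suc j)))) (zeroʳ (q′ j))))
    ... | no  i≢r    = trans (row r)
      (≡.subst (λ t → sum (λ j → q′ j * W′ t j) ≈ 0#) (punchIn-punchOut i≢r)
        (proj₂ (proj₂ reduced) (punchOut i≢r)))

-- The relation between off-diagonal entries of powers.

-- The coordinates of (A ^ m) at S vanish for m = 0, so only n conditions on q remain.
offDiagonalRelation : ∀ {R} → IsDecidableDomain R → ∀ {n} →
  let open RawRing R
      open Matrices R
  in (A : Matrix (suc n)) (S : Fin (suc n) → Fin (suc n) × Fin (suc n)) →
     (∀ k → proj₁ (S k) ≢ proj₂ (S k)) →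
     Σ[ q ∈ (Fin (suc n) → Carrier) ]
       (∃[ k ] q k ≉ 0#) ×
       (∀ m → sum (λ k → q k * (A ^ₘ m) at (S k)) ≈ 0#)
offDiagonalRelation {R} R-domain {n} A S offDiagonal =
  q , q≉0 , CayleyHamilton.combination-zero A q S initial
  where
  open IsDecidableDomain R-domain using (commutativeRing)
  open CommutativeRing commutativeRing hiding (zero)
  open LinearSystems R-domain using (nontrivialSolution)
  open LinearRecurrences commutativeRing using (module CayleyHamilton)
  open Sums commutativeRing
  open Matrices R using (1ₘ; _^ₘ_; _at_)

  -- The matrix has size `suc n` and the exponents imposed are `1` to `n`, one equation fewer than
  -- there are unknowns.
  solution = nontrivialSolution n (λ i k → (A ^ₘ suc (toℕ i)) at S k)
  q = proj₁ solution
  q≉0 = proj₁ (proj₂ solution)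

  initial : ∀ m → m < suc n → sum (λ k → q k * (A ^ₘ m) at S k) ≈ 0#
  initial zero    _         = sum-zero (λ k → q k * 1ₘ at S k) λ k →
    trans (*-congˡ (1ₘ-offDiagonal _ _ (offDiagonal k))) (zeroʳ (q k))
  initial (suc m) (ℕ.s≤s m<n) =
    ≡.subst (λ t → sum (λ k → q k * (A ^ₘ suc t) at S k) ≈ 0#) (toℕ-fromℕ< m<n)
      (proj₂ (proj₂ solution) (fromℕ< m<n))

-- Specialisation to the general matrix over the rational polynomials.

mainTheorem2 :
  (n : ℕ) → 2 ≤ n →
  (S : Fin n → Fin n × Fin n) →
  Injective _≡_ _≡_ S →
  (∀ k → proj₁ (S k) ≢ proj₂ (S k)) →
  let open RawRing (ℚ[a] n)
      open Matrices (ℚ[a] n)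
      A = generalMatrix n
  in Σ[ q ∈ (Fin n → Carrier) ]
       (∃[ k ] q k ≉ 0#) ×
       (∀ m → 1 < m → sum (λ k → q k * (A ^ₘ m) at (S k)) ≈ 0#)
mainTheorem2 n@(suc _) _ S _ offDiagonal =
  proj₁ relation , proj₁ (proj₂ relation) , λ m _ → proj₂ (proj₂ relation) m
  where
  relation = offDiagonalRelation ℚ[ n ℕ.* n ]-isDecidableDomain (generalMatrix n) S offDiagonal
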